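{- There is an absolute constant $c>0$ such that for all $\varepsilon,\delta\in(0,1)$ the following holds: any sublinear algorithm which, for every finite input multiset $A\subset\mathbb{R}^d$, outputs a $(1+\varepsilon)$-approximate mean of $A$ with probability at least $1-\delta$ must sample at least $c\,\varepsilon^{ -1}\log\delta^{ -1}$ points.
   Context: For a finite multiset $A\subset\mathbb{R}^d$ with $|A|=n$, let $\mathrm{Opt}=\min_{x\in\mathbb{R}^d}\sum_{p\in A}\|p-x\|^2$. A point $x$ is a $(1+\varepsilon)$-approximate mean of $A$ if $\sum_{p\in A}\|p-x\|^2\le(1+\varepsilon)\mathrm{Opt}$. A sublinear algorithm accesses the input $A$ only by drawing points independently and uniformly at random from $A$ (it may use internal randomness); its output depends only on the sampled points and its internal randomness. -}

module Defs where

open import Level using (Level; _⊔_) renaming (suc to lsuc)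
open import Algebra.Apartness.Bundles using (HeytingField)
open import Algebra.Bundles using (CommutativeRing; Semiring)
import Algebra.Apartness.Properties.HeytingCommutativeRing as HeytingProperties
import Algebra.Definitions.RawSemiring as RawSemiringDefinitions
import Algebra.Properties.Ring as RingProperties
open import Data.Fin.Base using (Fin; toℕ)
open import Data.Nat.Base as ℕ using (ℕ; zero; suc; NonZero; _!)
open import Data.Nat.Properties using (_!≢0)
open import Data.Product.Base using (Σ-syntax; ∃; ∃-syntax; _×_; _,_; proj₁)
open import Data.Sum.Base using (_⊎_; inj₁; inj₂)
open import Data.Unit.Polymorphic.Base using (⊤)
open import Data.Vec.Functional using (Vector; []; _∷_)
open import Function.Base using (_∘_)
open import Function.Bundles using (_⇔_; Equivalence)
open import Relation.Binary.Core using (Rel)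
open import Relation.Binary.PropositionalEquality.Core using (_≢_)
open import Relation.Binary.Structures using (IsStrictPartialOrder)
open import Relation.Nullary.Negation using (¬_)
open import Relation.Unary using (Pred; _⊆_; _≐_; _⊥_; _∪_; ∁; ⋃)

-- The real numbers are axiomatised as a Cauchy-complete Archimedean ordered
-- (Heyting) field.  Classically this determines ℝ up to unique isomorphism;
-- constructively both the Cauchy reals and the Dedekind reals are models.
record RealNumbers c ℓ₁ ℓ₂ ℓ₃ : Set (lsuc (c ⊔ ℓ₁ ⊔ ℓ₂ ⊔ ℓ₃)) where
  infix 4 _<_ _≤_ _⟶_

  field
    heytingField : HeytingField c ℓ₁ ℓ₂

  open HeytingField heytingField public renaming (Carrier to ℝ)

  commutativeRing : CommutativeRing c ℓ₁
  commutativeRing = record { isCommutativeRing = isCommutativeRing }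

  open RawSemiringDefinitions (Semiring.rawSemiring (CommutativeRing.semiring commutativeRing)) public
    using (sum; _^_) renaming (_×_ to _·_)

  fromℕ : ℕ → ℝ
  fromℕ n = n · 1#

  field
    _<_                    : Rel ℝ ℓ₃
    <-isStrictPartialOrder : IsStrictPartialOrder _≈_ _<_
    #⇔<⊎>                  : ∀ x y → (x # y) ⇔ (x < y ⊎ y < x)
    +-monoʳ-<              : ∀ x {y z} → y < z → x + y < x + z
    *-positive             : ∀ {x y} → 0# < x → 0# < y → 0# < x * y
    archimedean            : ∀ x → ∃[ n ] x < fromℕ n

  _≤_ : Rel ℝ ℓ₃
  x ≤ y = ¬ (y < x)

  Cauchy : (ℕ → ℝ) → Set (c ⊔ ℓ₃)
  Cauchy s = ∀ e → 0# < e →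
    ∃[ N ] (∀ m n → N ℕ.≤ m → N ℕ.≤ n → s m < s n + e)

  _⟶_ : (ℕ → ℝ) → ℝ → Set (c ⊔ ℓ₃)
  s ⟶ l = ∀ e → 0# < e →
    ∃[ N ] (∀ n → N ℕ.≤ n → s n < l + e × l < s n + e)

  field
    complete : ∀ s → Cauchy s → ∃[ l ] s ⟶ l

module Real {c ℓ₁ ℓ₂ ℓ₃} (R : RealNumbers c ℓ₁ ℓ₂ ℓ₃) where

  open RealNumbers R public

  private
    module < = IsStrictPartialOrder <-isStrictPartialOrder
    module HP = HeytingProperties (HeytingField.heytingCommutativeRing heytingField)
    module RP = RingProperties (CommutativeRing.ring commutativeRing)

  0<1 : 0# < 1#
  0<1 with Equivalence.to (#⇔<⊎> 1# 0#) HP.1#0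
  ... | inj₂ 0<1 = 0<1
  ... | inj₁ 1<0 = <.<-respʳ-≈ -1*-1≈1 (*-positive 0<-1 0<-1)
    where
    0<-1 : 0# < - 1#
    0<-1 = <.<-respʳ-≈ (+-identityʳ (- 1#))
             (<.<-respˡ-≈ (-‿inverseˡ 1#) (+-monoʳ-< (- 1#) 1<0))

    -1*-1≈1 : - 1# * - 1# ≈ 1#
    -1*-1≈1 = trans (RP.-1*x≈-x (- 1#)) (RP.-‿involutive 1#)

  0<fromℕ : ∀ n .{{_ : NonZero n}} → 0# < fromℕ n
  0<fromℕ 1             = <.<-respʳ-≈ (sym (+-identityʳ 1#)) 0<1
  0<fromℕ (suc (suc n)) =
    <.trans 0<1 (<.<-respˡ-≈ (+-identityʳ 1#) (+-monoʳ-< 1# (0<fromℕ (suc n))))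

  inverse : ∀ x → 0# < x → ℝ
  inverse x 0<x = proj₁ (#⇒invertible (Equivalence.from (#⇔<⊎> x 0#) (inj₂ 0<x)))

  1/ : ∀ n .{{_ : NonZero n}} → ℝ
  1/ n = inverse (fromℕ n) (0<fromℕ n)

  partialSum : (ℕ → ℝ) → ℕ → ℝ
  partialSum a n = sum {n} (a ∘ toℕ)

  IsExp : ℝ → ℝ → Set (c ⊔ ℓ₃)
  IsExp x y = partialSum (λ k → x ^ k * 1/ (k !) {{k !≢0}}) ⟶ y

  -- The natural logarithm, as the inverse of the exponential function.
  IsLog : ℝ → ℝ → Set (c ⊔ ℓ₃)
  IsLog y x = IsExp x y

  -- Classically these are exactly the probability spaces: the partial sums in
  -- ⋃-event always converge, P-∁ follows from P-∪, and closure under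
  -- complements, finite unions and countable disjoint unions gives a σ-algebra.
  -- Constructively, requiring ⋃-event without the convergence hypothesis would
  -- rule out even the one-point space.
  record ProbabilitySpace o e i : Set (lsuc (o ⊔ e ⊔ i) ⊔ c ⊔ ℓ₁ ⊔ ℓ₃) where
    field
      Ω       : Set o
      IsEvent : Pred Ω e → Set i
      P       : ∀ {A} → IsEvent A → ℝ

      U-event      : IsEvent (λ _ → ⊤)
      ∁-event      : ∀ {A} → IsEvent A → IsEvent (∁ A)
      ∪-event      : ∀ {A B} → IsEvent A → IsEvent B → IsEvent (A ∪ B)
      event-resp-≐ : ∀ {A B} → A ≐ B → IsEvent A → IsEvent B

      P-nonNegative : ∀ {A} (a : IsEvent A) → 0# ≤ P a
      P-U           : P U-event ≈ 1#
      P-∁           : ∀ {A} (a : IsEvent A) → P a + P (∁-event a) ≈ 1#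
      P-∪           : ∀ {A B} (a : IsEvent A) (b : IsEvent B) → A ⊥ B →
                      P (∪-event a b) ≈ P a + P b

      ⋃-event : ∀ (A : ℕ → Pred Ω e) (a : ∀ k → IsEvent (A k)) →
                (∀ {j k} → j ≢ k → A j ⊥ A k) →
                ∀ p → partialSum (λ k → P (a k)) ⟶ p →
                Σ[ u ∈ IsEvent (⋃ ℕ A) ] P u ≈ p

  Point : ℕ → Set c
  Point d = Vector ℝ d

  _≈ᵖ_ : ∀ {d} → Rel (Point d) ℓ₁
  x ≈ᵖ y = ∀ i → x i ≈ y i

  ‖_-_‖² : ∀ {d} → Point d → Point d → ℝ
  ‖ p - x ‖² = sum (λ i → (p i - x i) ^ 2)

  -- A finite multiset of points is given by an enumeration with repetitions.
  cost : ∀ {d n} → Vector (Point d) n → Point d → ℝ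
  cost A x = sum (λ j → ‖ A j - x ‖²)

  IsOpt : ∀ {d n} → Vector (Point d) n → ℝ → Set (c ⊔ ℓ₁ ⊔ ℓ₃)
  IsOpt A v = (∃[ x ] cost A x ≈ v) × (∀ x → v ≤ cost A x)

  IsApproxMean : ∀ {d n} → ℝ → Vector (Point d) n → Point d → Set (c ⊔ ℓ₁ ⊔ ℓ₃)
  IsApproxMean ε A x = ∃[ v ] IsOpt A v × cost A x ≤ (1# + ε) * v

  record SublinearAlgorithm (d m : ℕ) o e i : Set (lsuc (o ⊔ e ⊔ i) ⊔ c ⊔ ℓ₁ ⊔ ℓ₃) where
    field
      randomness : ProbabilitySpace o e i

    open ProbabilitySpace randomness public

    field
      output      : Vector (Point d) m → Ω → Point d
      output-cong : ∀ {y z} → (∀ j → y j ≈ᵖ z j) → ∀ ω → output y ω ≈ᵖ output z ω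

  -- The expectation of f over m independent uniform draws from Fin n.
  average : ∀ {n} .{{_ : NonZero n}} m → (Vector (Fin n) m → ℝ) → ℝ
  average     zero    f = f []
  average {n} (suc m) f = 1/ n * sum (λ j → average m (λ s → f (j ∷ s)))

  -- With probability at least q over the sample and the independent internal
  -- randomness, the output is a (1+ε)-approximate mean of A.  Events of the
  -- product space are families E of events indexed by the sampled positions s.
  -- Success is required to contain an event of probability at least q, which
  -- amounts to P(success) ≥ q whenever success is itself an event.
  ApproximatesMean : ∀ {d m n o e i} .{{_ : NonZero n}} →
    SublinearAlgorithm d m o e i → ℝ → ℝ → Vector (Point d) n →
    Set (c ⊔ ℓ₁ ⊔ ℓ₃ ⊔ o ⊔ lsuc e ⊔ i)
  ApproximatesMean {m = m} {n} {e = e} 𝒜 ε q A =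
    Σ[ E ∈ (Vector (Fin n) m → Pred Ω e) ]
    Σ[ isEvent ∈ (∀ s → IsEvent (E s)) ]
      (∀ s → E s ⊆ (λ ω → IsApproxMean ε A (output (A ∘ s) ω)))
      × q ≤ average m (λ s → P (isEvent s))
    where open SublinearAlgorithm 𝒜

{-# OPTIONS --safe #-}

-- Take N with Nε < 1 ≤ (N+1)ε and let A_k consist of N copies of the origin and
-- one point at distance (N+1)M^k from it.  Every (1+ε)-approximate mean of A_k
-- lies within √(Nε)·M^k of M^k on the axis, so for M large the sets of
-- approximate means of A_0, A_1, … are pairwise disjoint.  A sample missing the
-- far point, which has probability (N/(N+1))^m, does not reveal k, so the
-- algorithm then succeeds with probability at most 1/K on average over k < K.
-- Letting K → ∞ gives (N/(N+1))^m ≤ δ, that is δ⁻¹ ≤ (1 + 1/N)^m ≤ exp(m/N),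
-- and N⁻¹ ≤ 2ε.
--
-- Since ≤ is the negation of >, each inequality x ≤ y may be proved classically.
module Submission where

open import Defs
open import Algebra.Apartness.Bundles using (HeytingField)
import Algebra.Apartness.Properties.HeytingCommutativeRing as HeytingProperties
open import Algebra.Bundles using (CommutativeRing)
import Algebra.Properties.CommutativeSemiring.Exp as CommutativeSemiringExp
import Algebra.Properties.Ring as RingProperties
import Algebra.Properties.Semiring.Exp as SemiringExp
import Algebra.Properties.Semiring.Mult as SemiringMult
import Algebra.Properties.Semiring.Mult.TCOptimised as SemiringMult′
import Algebra.Properties.Semiring.Sum as SemiringSum
import Algebra.Solver.Ring
open import Algebra.Solver.Ring.AlmostCommutativeRing
  using (fromCommutativeRing; _-Raw-AlmostCommutative⟶_)
open import Data.Empty using (⊥-elim)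
open import Data.Fin.Base using (Fin; zero; suc; toℕ)
open import Data.Fin.Properties using (suc-injective; toℕ-injective)
open import Data.Integer.Base as ℤ using (ℤ; +_; -[1+_])
import Data.Integer.Properties as ℤ
open import Data.Maybe.Base using (Maybe; map)
open import Data.Nat.Base as ℕ using (ℕ; NonZero; zero; suc; z≤n; s≤s; _!; _⊔_)
open import Data.Nat.Properties as ℕ using (_!≢0)
open import Data.Product.Base using (Σ-syntax; ∃-syntax; _×_; _,_; proj₁; proj₂)
open import Data.Sign.Base as Sign using (Sign)
open import Data.Sum.Base using (_⊎_; inj₁; inj₂; [_,_])
open import Data.Unit.Polymorphic.Base using (⊤)
open import Data.Vec.Functional using (Vector; []; _∷_)
open import Function.Base using (_∘_)
open import Function.Bundles using (Equivalence)
open import Relation.Binary.Consequences using (dec⇒weaklyDec)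
open import Relation.Binary.Definitions using (tri<; tri≈; tri>)
open import Relation.Binary.PropositionalEquality.Core as ≡ using (_≢_)
import Relation.Binary.Reasoning.Base.Triple as TripleReasoning
import Relation.Binary.Reasoning.Setoid as SetoidReasoning
open import Relation.Binary.Structures using (IsPreorder; IsStrictPartialOrder)
open import Relation.Nullary.Negation using (¬_)
open import Relation.Unary using (Pred; _⊥_; ∁)

-- A ring solver with integer coefficients.

module IntegerCoefficientSolver {c ℓ} (R : CommutativeRing c ℓ) where
  open CommutativeRing R
  open RingProperties ring using (-0#≈0#; -‿involutive; -‿+-comm; -1*x≈-x)
  open SemiringMult′ semiring using (1+×; ×-homo-+; ×1-homo-*) renaming (_×_ to _·_)
  open SetoidReasoning setoid

  private
    -- Equality on the carrier need not be decidable, so the solver normalises over the integers and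
    -- interprets coefficients by this homomorphism. The optimised multiple makes `ι (+ 1)` reduce
    -- to `1#` itself, so `con (+ 1)` matches the `1#` of a goal.
    ι : ℤ → Carrier
    ι (+ n)    = n · 1#
    ι -[1+ n ] = - (suc n · 1#)

    σ : Sign → Carrier
    σ Sign.+ = 1#
    σ Sign.- = - 1#

    ι-⊖ : ∀ m n → ι (m ℤ.⊖ n) ≈ m · 1# - n · 1#
    ι-⊖ m       zero    = sym (trans (+-congˡ -0#≈0#) (+-identityʳ _))
    ι-⊖ zero    (suc n) = sym (+-identityˡ _)
    ι-⊖ (suc m) (suc n) = begin
      ι (suc m ℤ.⊖ suc n)                        ≡⟨ ≡.cong ι (ℤ.[1+m]⊖[1+n]≡m⊖n m n) ⟩
      ι (m ℤ.⊖ n)                                ≈⟨ ι-⊖ m n ⟩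
      m · 1# - n · 1#                            ≈⟨ +-congʳ (+-identityˡ _) ⟨
      0# + m · 1# - n · 1#                       ≈⟨ +-congʳ (+-congʳ (-‿inverseʳ 1#)) ⟨
      1# - 1# + m · 1# - n · 1#                  ≈⟨ +-congʳ (+-assoc 1# (- 1#) _) ⟩
      1# + (- 1# + m · 1#) - n · 1#              ≈⟨ +-congʳ (+-congˡ (+-comm (- 1#) _)) ⟩
      1# + (m · 1# - 1#) - n · 1#                ≈⟨ +-congʳ (+-assoc 1# _ _) ⟨
      1# + m · 1# - 1# - n · 1#                  ≈⟨ +-assoc _ _ _ ⟩
      1# + m · 1# + (- 1# - n · 1#)              ≈⟨ +-congˡ (-‿+-comm 1# _) ⟩
      1# + m · 1# - (1# + n · 1#)                ≈⟨ +-cong (1+× m 1#) (-‿cong (1+× n 1#)) ⟨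
      suc m · 1# - suc n · 1#                    ∎

    ι-◃ : ∀ s n → ι (s ℤ.◃ n) ≈ σ s * n · 1#
    ι-◃ s      zero    = sym (zeroʳ (σ s))
    ι-◃ Sign.+ (suc n) = sym (*-identityˡ _)
    ι-◃ Sign.- (suc n) = sym (-1*x≈-x _)

    σ-* : ∀ s t → σ (s Sign.* t) ≈ σ s * σ t
    σ-* Sign.+ t      = sym (*-identityˡ (σ t))
    σ-* Sign.- Sign.+ = sym (*-identityʳ (- 1#))
    σ-* Sign.- Sign.- = sym (trans (-1*x≈-x (- 1#)) (-‿involutive 1#))

    ι-sign : ∀ i → ι i ≈ σ (ℤ.sign i) * ℤ.∣ i ∣ · 1#
    ι-sign (+ n)    = sym (*-identityˡ _)
    ι-sign -[1+ n ] = sym (-1*x≈-x _)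

    ι-+ : ∀ i j → ι (i ℤ.+ j) ≈ ι i + ι j
    ι-+ (+ m)    (+ n)    = ×-homo-+ 1# m n
    ι-+ (+ m)    -[1+ n ] = ι-⊖ m (suc n)
    ι-+ -[1+ m ] (+ n)    = trans (ι-⊖ n (suc m)) (+-comm _ _)
    ι-+ -[1+ m ] -[1+ n ] = begin
      - (suc (suc (m ℕ.+ n)) · 1#)          ≈⟨ -‿cong (1+× (suc m ℕ.+ n) 1#) ⟩
      - (1# + (suc m ℕ.+ n) · 1#)           ≈⟨ -‿cong (+-congˡ (×-homo-+ 1# (suc m) n)) ⟩
      - (1# + (suc m · 1# + n · 1#))        ≈⟨ -‿cong (+-assoc 1# _ _) ⟨
      - (1# + suc m · 1# + n · 1#)          ≈⟨ -‿cong (+-congʳ (+-comm 1# _)) ⟩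
      - (suc m · 1# + 1# + n · 1#)          ≈⟨ -‿cong (+-assoc _ 1# _) ⟩
      - (suc m · 1# + (1# + n · 1#))        ≈⟨ -‿cong (+-congˡ (1+× n 1#)) ⟨
      - (suc m · 1# + suc n · 1#)           ≈⟨ -‿+-comm _ _ ⟨
      - (suc m · 1#) - suc n · 1#           ∎

    ι-* : ∀ i j → ι (i ℤ.* j) ≈ ι i * ι j
    ι-* i j = begin
      ι (i ℤ.* j)                                              ≈⟨ ι-◃ (s Sign.* t) (m ℕ.* n) ⟩
      σ (s Sign.* t) * (m ℕ.* n) · 1#                          ≈⟨ *-cong (σ-* s t) (×1-homo-* m n) ⟩
      (σ s * σ t) * (m · 1# * n · 1#)                          ≈⟨ *-assoc (σ s) _ _ ⟩
      σ s * (σ t * (m · 1# * n · 1#))                          ≈⟨ *-congˡ (*-assoc (σ t) _ _) ⟨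
      σ s * (σ t * m · 1# * n · 1#)                            ≈⟨ *-congˡ (*-congʳ (*-comm (σ t) _)) ⟩
      σ s * (m · 1# * σ t * n · 1#)                            ≈⟨ *-congˡ (*-assoc _ (σ t) _) ⟩
      σ s * (m · 1# * (σ t * n · 1#))                          ≈⟨ *-assoc (σ s) _ _ ⟨
      (σ s * m · 1#) * (σ t * n · 1#)                          ≈⟨ *-cong (ι-sign i) (ι-sign j) ⟨
      ι i * ι j                                                ∎
      where
      s = ℤ.sign i
      t = ℤ.sign j
      m = ℤ.∣ i ∣
      n = ℤ.∣ j ∣

    ι-neg : ∀ i → ι (ℤ.- i) ≈ - ι i
    ι-neg (+ zero)  = sym -0#≈0#
    ι-neg (+ suc n) = refl
    ι-neg -[1+ n ]  = sym (-‿involutive _)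

    homomorphism : ℤ.+-*-rawRing -Raw-AlmostCommutative⟶ fromCommutativeRing R
    homomorphism = record
      { ⟦_⟧    = ι
      ; +-homo = ι-+
      ; *-homo = ι-*
      ; -‿homo = ι-neg
      ; 0-homo = refl
      ; 1-homo = refl
      }

    _≟_ : ∀ i j → Maybe (ι i ≈ ι j)
    i ≟ j = map (λ i≡j → reflexive (≡.cong ι i≡j)) (dec⇒weaklyDec ℤ._≟_ i j)

  open Algebra.Solver.Ring ℤ.+-*-rawRing (fromCommutativeRing R) homomorphism _≟_ public
    using (solve; con; _:+_; _:*_; _:-_; _:=_; _:^_)

module LowerBound {c ℓ₁ ℓ₂ ℓ₃} (R : RealNumbers c ℓ₁ ℓ₂ ℓ₃) where

  open Real R hiding (zero)
  open CommutativeRing commutativeRing using (semiring; commutativeSemiring)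
  open IsStrictPartialOrder <-isStrictPartialOrder using (<-resp-≈; <-respˡ-≈; <-respʳ-≈)
    renaming (irrefl to <-irrefl; trans to <-trans; asym to <-asym)
  open HeytingProperties (HeytingField.heytingCommutativeRing heytingField)
    using (x-0≈x; invertibleʳ⇒#)
  open CommutativeSemiringExp commutativeSemiring using (^-distrib-*)
  open SemiringExp semiring using (^-congˡ)
  open SemiringMult semiring using (×1-homo-*)
  open SemiringSum semiring using (∑-comm; ∑-distrib-+; *-distribˡ-sum; sum-cong-≋)
  open IntegerCoefficientSolver commutativeRing

  -- Order and arithmetic of the reals.

  <⇒≤ : ∀ {x y} → x < y → x ≤ y
  <⇒≤ = <-asym

  -- Tightness turns the failure of apartness into equality. Refuting all three cases gives
  -- absurdity, which is the case split available when the goal is a negation.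
  ¬¬-trichotomy : ∀ x y → ¬ x < y → ¬ x ≈ y → ¬ ¬ y < x
  ¬¬-trichotomy x y x≮y x≉y y≮x = x≉y (proj₁ (tight x y) λ x#y → split (Equivalence.to (#⇔<⊎> x y) x#y))
    where
    split : ¬ (x < y ⊎ y < x)
    split (inj₁ x<y) = x≮y x<y
    split (inj₂ y<x) = y≮x y<x

  ≤-<-trans : ∀ {x y z} → x ≤ y → y < z → x < z
  ≤-<-trans {x} {y} {z} x≤y y<z with #-cotrans (Equivalence.from (#⇔<⊎> y z) (inj₁ y<z)) x
  ... | inj₁ y#x with Equivalence.to (#⇔<⊎> y x) y#x
  ...   | inj₁ y<x = ⊥-elim (x≤y y<x)
  ...   | inj₂ x<y = <-trans x<y y<z
  ≤-<-trans {x} {y} {z} x≤y y<z | inj₂ x#z with Equivalence.to (#⇔<⊎> x z) x#z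
  ...   | inj₁ x<z = x<z
  ...   | inj₂ z<x = ⊥-elim (x≤y (<-trans y<z z<x))

  <-≤-trans : ∀ {x y z} → x < y → y ≤ z → x < z
  <-≤-trans {x} {y} {z} x<y y≤z with #-cotrans (Equivalence.from (#⇔<⊎> x y) (inj₁ x<y)) z
  ... | inj₁ x#z with Equivalence.to (#⇔<⊎> x z) x#z
  ...   | inj₁ x<z = x<z
  ...   | inj₂ z<x = ⊥-elim (y≤z (<-trans z<x x<y))
  <-≤-trans {x} {y} {z} x<y y≤z | inj₂ z#y with Equivalence.to (#⇔<⊎> z y) z#y
  ...   | inj₁ z<y = ⊥-elim (y≤z z<y)
  ...   | inj₂ y<z = <-trans x<y y<z

  ≤-trans : ∀ {x y z} → x ≤ y → y ≤ z → x ≤ z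
  ≤-trans x≤y y≤z z<x = y≤z (<-≤-trans z<x x≤y)

  ≤-reflexive : ∀ {x y} → x ≈ y → x ≤ y
  ≤-reflexive x≈y y<x = <-irrefl (sym x≈y) y<x

  ≤-refl : ∀ {x} → x ≤ x
  ≤-refl = ≤-reflexive refl

  ≤-isPreorder : IsPreorder _≈_ _≤_
  ≤-isPreorder = record
    { isEquivalence = isEquivalence
    ; reflexive     = ≤-reflexive
    ; trans         = ≤-trans
    }

  module ≤-Reasoning =
    TripleReasoning ≤-isPreorder <-asym <-trans <-resp-≈ <⇒≤ <-≤-trans ≤-<-trans

  0<y-x : ∀ {x y} → x < y → 0# < y - x
  0<y-x {x} {y} x<y = <-respˡ-≈ (-‿inverseˡ x) (<-respʳ-≈ (+-comm (- x) y) (+-monoʳ-< (- x) x<y))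

  x<y⇐0<y-x : ∀ {x y} → 0# < y - x → x < y
  x<y⇐0<y-x {x} {y} 0<y-x =
    <-respˡ-≈ (+-identityʳ x)
      (<-respʳ-≈ (solve 2 (λ x y → x :+ (y :- x) := y) refl x y) (+-monoʳ-< x 0<y-x))

  0≤y-x : ∀ {x y} → x ≤ y → 0# ≤ y - x
  0≤y-x {x} {y} x≤y y-x<0 = x≤y
    (<-respˡ-≈ (solve 2 (λ x y → x :+ (y :- x) := y) refl x y)
      (<-respʳ-≈ (+-identityʳ x) (+-monoʳ-< x y-x<0)))

  x≤y⇐0≤y-x : ∀ {x y} → 0# ≤ y - x → x ≤ y
  x≤y⇐0≤y-x {x} {y} 0≤y-x y<x = 0≤y-x
    (<-respˡ-≈ (+-comm (- x) y) (<-respʳ-≈ (-‿inverseˡ x) (+-monoʳ-< (- x) y<x)))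

  +-monoʳ-≤ : ∀ x {y z} → y ≤ z → x + y ≤ x + z
  +-monoʳ-≤ x {y} {z} y≤z = x≤y⇐0≤y-x
    (≤-trans (0≤y-x y≤z) (≤-reflexive (solve 3 (λ x y z → z :- y := (x :+ z) :- (x :+ y)) refl x y z)))

  +-monoˡ-≤ : ∀ x {y z} → y ≤ z → y + x ≤ z + x
  +-monoˡ-≤ x {y} {z} y≤z =
    ≤-trans (≤-reflexive (+-comm y x)) (≤-trans (+-monoʳ-≤ x y≤z) (≤-reflexive (+-comm x z)))

  +-mono-≤ : ∀ {x y u v} → x ≤ y → u ≤ v → x + u ≤ y + v
  +-mono-≤ {x} {y} {u} {v} x≤y u≤v = ≤-trans (+-monoˡ-≤ u x≤y) (+-monoʳ-≤ y u≤v)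

  +-cancelˡ-≤ : ∀ x {y z} → x + y ≤ x + z → y ≤ z
  +-cancelˡ-≤ x x+y≤x+z z<y = x+y≤x+z (+-monoʳ-< x z<y)

  *-nonNegative : ∀ {x y} → 0# ≤ x → 0# ≤ y → 0# ≤ x * y
  *-nonNegative {x} {y} 0≤x 0≤y xy<0 =
    ¬¬-trichotomy 0# x
      (λ 0<x → ¬¬-trichotomy 0# y
        (λ 0<y → <-asym xy<0 (*-positive 0<x 0<y))
        (λ 0≈y → <-irrefl (trans (*-congˡ (sym 0≈y)) (zeroʳ x)) xy<0)
        0≤y)
      (λ 0≈x → <-irrefl (trans (*-congʳ (sym 0≈x)) (zeroˡ y)) xy<0)
      0≤x

  *-monoʳ-≤ : ∀ {x y z} → 0# ≤ x → y ≤ z → x * y ≤ x * z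
  *-monoʳ-≤ {x} {y} {z} 0≤x y≤z = x≤y⇐0≤y-x
    (≤-trans (*-nonNegative 0≤x (0≤y-x y≤z))
      (≤-reflexive (solve 3 (λ x y z → x :* (z :- y) := x :* z :- x :* y) refl x y z)))

  *-monoʳ-< : ∀ {x y z} → 0# < x → y < z → x * y < x * z
  *-monoʳ-< {x} {y} {z} 0<x y<z = x<y⇐0<y-x
    (<-respʳ-≈ (solve 3 (λ x y z → x :* (z :- y) := x :* z :- x :* y) refl x y z)
      (*-positive 0<x (0<y-x y<z)))

  *-monoˡ-≤ : ∀ {x y z} → 0# ≤ x → y ≤ z → y * x ≤ z * x
  *-monoˡ-≤ {x} {y} {z} 0≤x y≤z =
    ≤-trans (≤-reflexive (*-comm y x)) (≤-trans (*-monoʳ-≤ 0≤x y≤z) (≤-reflexive (*-comm x z)))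

  *-mono-≤ : ∀ {x y u v} → 0# ≤ x → 0# ≤ v → x ≤ y → u ≤ v → x * u ≤ y * v
  *-mono-≤ 0≤x 0≤v x≤y u≤v = ≤-trans (*-monoʳ-≤ 0≤x u≤v) (*-monoˡ-≤ 0≤v x≤y)

  *-cancelˡ-≤ : ∀ {x y z} → 0# < x → x * y ≤ x * z → y ≤ z
  *-cancelˡ-≤ 0<x xy≤xz z<y = xy≤xz (*-monoʳ-< 0<x z<y)

  square-nonNegative : ∀ x → 0# ≤ x ^ 2
  square-nonNegative x x²<0 = ¬¬-trichotomy 0# x
    (λ 0<x → <-asym x²<0 (<-respʳ-≈ x*x≈x² (*-positive 0<x 0<x)))
    (λ 0≈x → <-irrefl (trans (*-congʳ (sym 0≈x)) (zeroˡ _)) x²<0)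
    (λ x<0 → <-asym x²<0 (<-respʳ-≈ 0-x*0-x≈x² (*-positive (0<y-x x<0) (0<y-x x<0))))
    where
    x*x≈x² = solve 1 (λ x → x :* x := x :^ 2) refl x
    0-x*0-x≈x² = solve 1 (λ x → (con (+ 0) :- x) :* (con (+ 0) :- x) := x :^ 2) refl x

  ^-nonNegative : ∀ {x} → 0# ≤ x → ∀ k → 0# ≤ x ^ k
  ^-nonNegative 0≤x zero    = <⇒≤ 0<1
  ^-nonNegative 0≤x (suc k) = *-nonNegative 0≤x (^-nonNegative 0≤x k)

  ^-positive : ∀ {x} → 0# < x → ∀ k → 0# < x ^ k
  ^-positive 0<x zero    = 0<1
  ^-positive 0<x (suc k) = *-positive 0<x (^-positive 0<x k)

  -- Apartness from `0#` makes the difference `x - 0#` invertible, which is first rewritten to `x`.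
  *-inverseʳ : ∀ x (0<x : 0# < x) → x * inverse x 0<x ≈ 1#
  *-inverseʳ x 0<x = trans (*-congʳ (sym (x-0≈x x)))
    (proj₂ (proj₂ (#⇒invertible (Equivalence.from (#⇔<⊎> x 0#) (inj₂ 0<x)))))

  inverse-positive : ∀ x (0<x : 0# < x) → 0# < inverse x 0<x
  inverse-positive x 0<x with Equivalence.to (#⇔<⊎> x⁻¹ 0#) (invertibleʳ⇒# (x , right))
    where
    x⁻¹ = inverse x 0<x
    right : (x⁻¹ - 0#) * x ≈ 1#
    right = trans (*-congʳ (x-0≈x x⁻¹)) (trans (*-comm x⁻¹ x) (*-inverseʳ x 0<x))
  ... | inj₂ 0<x⁻¹ = 0<x⁻¹
  ... | inj₁ x⁻¹<0 = ⊥-elim (<-asym 0<1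
    (<-respˡ-≈ (*-inverseʳ x 0<x) (<-respʳ-≈ (zeroʳ x) (*-monoʳ-< 0<x x⁻¹<0))))

  0≤fromℕ : ∀ n → 0# ≤ fromℕ n
  0≤fromℕ zero    = ≤-refl
  0≤fromℕ (suc n) = <⇒≤ (0<fromℕ (suc n))

  2# : ℝ
  2# = 1# + 1#

  0<2 : 0# < 2#
  0<2 = <-trans 0<1 (<-respˡ-≈ (+-identityʳ 1#) (+-monoʳ-< 1# 0<1))

  0<⇒1<1+ : ∀ {x} → 0# < x → 1# < 1# + x
  0<⇒1<1+ 0<x = <-respˡ-≈ (+-identityʳ 1#) (+-monoʳ-< 1# 0<x)

  0≤⇒1≤1+ : ∀ {x} → 0# ≤ x → 1# ≤ 1# + x
  0≤⇒1≤1+ 0≤x = ≤-trans (≤-reflexive (sym (+-identityʳ 1#))) (+-monoʳ-≤ 1# 0≤x)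

  1≤⇒^-mono-≤ : ∀ {x} → 1# ≤ x → ∀ {j k} → j ℕ.≤ k → x ^ j ≤ x ^ k
  1≤⇒^-mono-≤ {x} 1≤x {k = zero}  z≤n = ≤-refl
  1≤⇒^-mono-≤ {x} 1≤x {k = suc k} z≤n = begin
    1#         ≤⟨ 1≤⇒^-mono-≤ 1≤x {k = k} z≤n ⟩
    x ^ k      ≈⟨ *-identityˡ _ ⟨
    1# * x ^ k ≤⟨ *-monoˡ-≤ (^-nonNegative 0≤x k) 1≤x ⟩
    x * x ^ k  ∎
    where
    open ≤-Reasoning
    0≤x = ≤-trans (<⇒≤ 0<1) 1≤x
  1≤⇒^-mono-≤ 1≤x (s≤s j≤k) = *-monoʳ-≤ (≤-trans (<⇒≤ 0<1) 1≤x) (1≤⇒^-mono-≤ 1≤x j≤k)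

  -- Sums

  sum-mono-≤ : ∀ {n} {f g : Vector ℝ n} → (∀ i → f i ≤ g i) → sum f ≤ sum g
  sum-mono-≤ {zero}  f≤g = ≤-refl
  sum-mono-≤ {suc n} f≤g = +-mono-≤ (f≤g zero) (sum-mono-≤ (f≤g ∘ suc))

  sum-const : ∀ n x → sum {n} (λ _ → x) ≈ fromℕ n * x
  sum-const zero    x = sym (zeroˡ x)
  sum-const (suc n) x = trans (+-congˡ (sum-const n x))
    (solve 2 (λ x k → x :+ k :* x := (con (+ 1) :+ k) :* x) refl x (fromℕ n))

  sum-≤-const : ∀ {n x} {f : Vector ℝ n} → (∀ i → f i ≤ x) → sum f ≤ fromℕ n * x
  sum-≤-const {n} {x} f≤x = ≤-trans (sum-mono-≤ f≤x) (≤-reflexive (sum-const n x))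

  const-≤-sum : ∀ {n x} {f : Vector ℝ n} → (∀ i → x ≤ f i) → fromℕ n * x ≤ sum f
  const-≤-sum {n} {x} x≤f = ≤-trans (≤-reflexive (sym (sum-const n x))) (sum-mono-≤ x≤f)

  sum-nonNegative : ∀ {n} {f : Vector ℝ n} → (∀ i → 0# ≤ f i) → 0# ≤ sum f
  sum-nonNegative {n} 0≤f = ≤-trans (≤-reflexive (sym (zeroʳ (fromℕ n)))) (const-≤-sum 0≤f)

  partialSum-mono-≤ : ∀ {a} → (∀ k → 0# ≤ a k) → ∀ {m n} → m ℕ.≤ n → partialSum a m ≤ partialSum a n
  partialSum-mono-≤ 0≤a {n = n} z≤n = sum-nonNegative {n} (0≤a ∘ toℕ)
  partialSum-mono-≤ 0≤a (s≤s m≤n) = +-monoʳ-≤ _ (partialSum-mono-≤ (0≤a ∘ suc) m≤n)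

  -- If a partial sum exceeded the limit, taking the excess as tolerance would force a later partial
  -- sum below it, against monotonicity.
  partialSum-≤-limit : ∀ {a l} → (∀ k → 0# ≤ a k) → partialSum a ⟶ l → ∀ n → partialSum a n ≤ l
  partialSum-≤-limit {a} {l} 0≤a a⟶l n l<sₙ = partialSum-mono-≤ 0≤a (ℕ.m≤n⊔m N n)
    (<-respʳ-≈ (solve 2 (λ l s → l :+ (s :- l) := s) refl l (partialSum a n))
      (proj₁ (proj₂ close (N ⊔ n) (ℕ.m≤m⊔n N n))))
    where
    close = a⟶l (partialSum a n - l) (0<y-x l<sₙ)
    N = proj₁ close

  0<1/ : ∀ n .{{_ : NonZero n}} → 0# < 1/ n
  0<1/ n = inverse-positive (fromℕ n) (0<fromℕ n)

  -- Averages over samples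

  -- Lets the success probabilities be summed over the candidate inputs for each fixed sample, where
  -- disjointness can be used.
  average-sum : ∀ {n k} .{{_ : NonZero n}} m (f : Fin k → Vector (Fin n) m → ℝ) →
    average m (λ s → sum (λ i → f i s)) ≈ sum (λ i → average m (f i))
  average-sum             zero    f = refl
  average-sum {n} {k} (suc m) f = begin
    1/ n * sum (λ j → average m (λ s → sum (λ i → f i (j ∷ s))))
      ≈⟨ *-congˡ (sum-cong-≋ (λ j → average-sum m (λ i s → f i (j ∷ s)))) ⟩
    1/ n * sum (λ j → sum (λ i → average m (λ s → f i (j ∷ s))))
      ≈⟨ *-congˡ (∑-comm (λ j i → average m (λ s → f i (j ∷ s)))) ⟩
    1/ n * sum (λ i → sum (λ j → average m (λ s → f i (j ∷ s))))
      ≈⟨ *-distribˡ-sum {k} (1/ n) _ ⟩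
    sum (λ i → average (suc m) (f i)) ∎
    where open SetoidReasoning setoid

  average-≤ : ∀ {n x} .{{_ : NonZero n}} m {f : Vector (Fin n) m → ℝ} →
    (∀ s → f s ≤ x) → average m f ≤ x
  average-≤         zero    f≤x = f≤x []
  average-≤ {n} {x} (suc m) {f} f≤x = begin
    average (suc m) f         ≤⟨ *-monoʳ-≤ (<⇒≤ (0<1/ n)) (sum-≤-const (λ j → average-≤ m (f≤x ∘ (j ∷_)))) ⟩
    1/ n * (fromℕ n * x)      ≈⟨ solve 3 (λ w k x → w :* (k :* x) := k :* w :* x) refl (1/ n) (fromℕ n) x ⟩
    fromℕ n * 1/ n * x        ≈⟨ *-congʳ (*-inverseʳ (fromℕ n) (0<fromℕ n)) ⟩
    1# * x                    ≈⟨ *-identityˡ x ⟩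
    x                         ∎
    where open ≤-Reasoning

  -- Samples avoiding position `zero` have total weight `(fromℕ N * 1/ (suc N)) ^ m`, and on them
  -- the bound improves by `x`. Induction on the first draw: `zero` leaves only the weak bound, and
  -- each of the other `N` positions passes to the remaining draws.
  average-miss-≤ : ∀ N m x {f : Vector (Fin (suc N)) m → ℝ} →
    (∀ s → f s ≤ 1# + x) → (∀ s → (∀ j → s j ≢ zero) → f s ≤ 1#) →
    average m f + x * (fromℕ N * 1/ (suc N)) ^ m ≤ 1# + x
  average-miss-≤ N zero    x f≤1+x f≤1 = +-mono-≤ (f≤1 [] λ ()) (≤-reflexive (*-identityʳ x))
  average-miss-≤ N (suc m) x {f} f≤1+x f≤1 = begin
    average (suc m) f + x * (k * w) ^ suc m
      ≤⟨ +-monoˡ-≤ _ (*-monoʳ-≤ (<⇒≤ (0<1/ (suc N)))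
           (+-mono-≤ (average-≤ m (f≤1+x ∘ (zero ∷_))) (sum-≤-const other))) ⟩
    w * ((1# + x) + k * ((1# + x) - x * (k * w) ^ m)) + x * (k * w) ^ suc m
      ≈⟨ solve 5 (λ w k x p o → w :* ((o :+ x) :+ k :* ((o :+ x) :- x :* p)) :+ x :* (k :* w :* p)
                              := w :* (o :+ x) :+ k :* w :* (o :+ x)) refl w k x ((k * w) ^ m) 1# ⟩
    w * (1# + x) + k * w * (1# + x)
      ≈⟨ solve 3 (λ w k x → w :* (con (+ 1) :+ x) :+ k :* w :* (con (+ 1) :+ x)
                          := (con (+ 1) :+ k) :* w :* (con (+ 1) :+ x)) refl w k x ⟩
    (1# + k) * w * (1# + x)
      ≈⟨ *-congʳ (*-inverseʳ (fromℕ (suc N)) (0<fromℕ (suc N))) ⟩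
    1# * (1# + x)
      ≈⟨ *-identityˡ (1# + x) ⟩
    1# + x ∎
    where
    open ≤-Reasoning
    k = fromℕ N
    w = 1/ (suc N)

    avoids : ∀ {i : Fin N} {s : Vector (Fin (suc N)) m} → (∀ j → s j ≢ zero) →
             ∀ j → (suc i ∷ s) j ≢ zero
    avoids s≢0 zero    ()
    avoids s≢0 (suc j) = s≢0 j

    other : ∀ i → average m (λ s → f (suc i ∷ s)) ≤ (1# + x) - x * (k * w) ^ m
    other i = begin
      average m (λ s → f (suc i ∷ s))
        ≈⟨ solve 2 (λ a b → a := a :+ b :- b) refl _ (x * (k * w) ^ m) ⟩
      average m (λ s → f (suc i ∷ s)) + x * (k * w) ^ m - x * (k * w) ^ m
        ≤⟨ +-monoˡ-≤ _ (average-miss-≤ N m x (f≤1+x ∘ (suc i ∷_)) (λ s s≢0 → f≤1 (suc i ∷ s) (avoids s≢0))) ⟩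
      (1# + x) - x * (k * w) ^ m ∎

  -- Finitely many disjoint events.

  module Probability {o e i} (𝒫 : ProbabilitySpace o e i) where
    open ProbabilitySpace 𝒫

    P≤1 : ∀ {A} (a : IsEvent A) → P a ≤ 1#
    P≤1 a = begin
      P a                   ≈⟨ +-identityʳ (P a) ⟨
      P a + 0#              ≤⟨ +-monoʳ-≤ (P a) (P-nonNegative (∁-event a)) ⟩
      P a + P (∁-event a)   ≈⟨ P-∁ a ⟩
      1#                    ∎
      where open ≤-Reasoning

    ∅-event : IsEvent (∁ (λ _ → ⊤))
    ∅-event = ∁-event U-event

    P-∅ : P ∅-event ≈ 0#
    P-∅ = begin
      P ∅-event                        ≈⟨ solve 2 (λ u v → v := u :+ v :- u) refl (P U-event) _ ⟩
      P U-event + P ∅-event - P U-event ≈⟨ +-cong (P-∁ U-event) (-‿cong P-U) ⟩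
      1# - 1#                          ≈⟨ -‿inverseʳ 1# ⟩
      0#                               ∎
      where open SetoidReasoning setoid

    -- Only the inclusion of `B` in the union is recorded: it keeps `B` disjoint from the next
    -- event, so that `P-∪` applies.
    finite-union : ∀ {k} (A : Fin k → Pred Ω e) (a : ∀ j → IsEvent (A j)) →
      (∀ {j k} → j ≢ k → A j ⊥ A k) →
      Σ[ B ∈ Pred Ω e ] Σ[ b ∈ IsEvent B ]
        (∀ {ω} → B ω → ∃[ j ] A j ω) × P b ≈ sum (λ j → P (a j))
    finite-union {zero}  A a disjoint = _ , ∅-event , (λ ω∈∅ → ⊥-elim (ω∈∅ _)) , P-∅
    finite-union {suc k} A a disjoint
      with B , b , B⊆A , Pb ← finite-union (A ∘ suc) (a ∘ suc) (λ j≢k → disjoint (j≢k ∘ suc-injective))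
      = _ , ∪-event (a zero) b
      , [ (zero ,_) , (λ ω∈B → let j , ω∈Aⱼ = B⊆A ω∈B in suc j , ω∈Aⱼ) ]
      , trans (P-∪ (a zero) b λ (ω∈A₀ , ω∈B) →
                 let j , ω∈Aⱼ = B⊆A ω∈B in disjoint {zero} {suc j} (λ ()) (ω∈A₀ , ω∈Aⱼ))
              (+-congˡ Pb)

    disjoint⇒sum≤1 : ∀ {k} {A : Fin k → Pred Ω e} (a : ∀ j → IsEvent (A j)) →
      (∀ {j k} → j ≢ k → A j ⊥ A k) → sum (λ j → P (a j)) ≤ 1#
    disjoint⇒sum≤1 a disjoint with _ , b , _ , Pb ← finite-union _ a disjoint =
      ≤-trans (≤-reflexive (sym Pb)) (P≤1 b)

  -- The exponential function

  private
    term : ℝ → ℕ → ℝ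
    term x k = x ^ k * 1/ (k !) {{k !≢0}}

  expSum : ℝ → ℕ → ℝ
  expSum x = partialSum (term x)

  private
    term-nonNegative : ∀ {x} → 0# ≤ x → ∀ k → 0# ≤ term x k
    term-nonNegative 0≤x k = *-nonNegative (^-nonNegative 0≤x k) (<⇒≤ (0<1/ (k !) {{k !≢0}}))

    1/k!≈ : ∀ k → fromℕ (suc k) * 1/ (suc k !) {{suc k !≢0}} ≈ 1/ (k !) {{k !≢0}}
    1/k!≈ k = begin
      s * u             ≈⟨ *-identityʳ (s * u) ⟨
      s * u * 1#        ≈⟨ *-congˡ (*-inverseʳ f (0<fromℕ (k !) {{k !≢0}})) ⟨
      s * u * (f * v)   ≈⟨ solve 4 (λ s u f v → s :* u :* (f :* v) := s :* f :* u :* v) refl s u f v ⟩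
      s * f * u * v     ≈⟨ *-congʳ (*-congʳ (×1-homo-* (suc k) (k !))) ⟨
      fromℕ (suc k !) * u * v ≈⟨ *-congʳ (*-inverseʳ _ (0<fromℕ (suc k !) {{suc k !≢0}})) ⟩
      1# * v            ≈⟨ *-identityˡ v ⟩
      v                 ∎
      where
      open SetoidReasoning setoid
      s = fromℕ (suc k)
      u = 1/ (suc k !) {{suc k !≢0}}
      f = fromℕ (k !)
      v = 1/ (k !) {{k !≢0}}

    -- The left side consists of the first two terms of the binomial expansion of `(x + h) ^ suc k`;
    -- the omitted terms are nonnegative.
    bernoulli : ∀ {x h y} → 0# ≤ x → 0# ≤ h → x + h ≤ y → ∀ k →
      x ^ suc k + fromℕ (suc k) * (x ^ k * h) ≤ y ^ suc k
    bernoulli {x} {h} {y} 0≤x 0≤h x+h≤y zero = begin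
      x * 1# + (1# + 0#) * (1# * h)  ≈⟨ solve 2 (λ x h →
               x :* con (+ 1) :+ (con (+ 1) :+ con (+ 0)) :* (con (+ 1) :* h) := x :+ h) refl x h ⟩
      x + h                          ≤⟨ x+h≤y ⟩
      y                              ≈⟨ *-identityʳ y ⟨
      y ^ 1                          ∎
      where open ≤-Reasoning
    bernoulli {x} {h} {y} 0≤x 0≤h x+h≤y (suc k) = begin
      x * (x * p) + (1# + s) * (x * p * h)
        ≈⟨ +-identityʳ _ ⟨
      x * (x * p) + (1# + s) * (x * p * h) + 0#
        -- The nonnegative term `s * (p * h ^ 2)` completes the sum to `x + h` times the left side
        -- of the induction hypothesis.
        ≤⟨ +-monoʳ-≤ _ (*-nonNegative (0≤fromℕ (suc k))
             (*-nonNegative (^-nonNegative 0≤x k) (square-nonNegative h))) ⟩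
      x * (x * p) + (1# + s) * (x * p * h) + s * (p * h ^ 2)
        ≈⟨ solve 4 (λ x p s h → x :* (x :* p) :+ (con (+ 1) :+ s) :* (x :* p :* h) :+ s :* (p :* h :^ 2)
                             := (x :+ h) :* (x :* p :+ s :* (p :* h))) refl x p s h ⟩
      (x + h) * (x * p + s * (p * h))
        ≤⟨ *-mono-≤ (+-nonNegative 0≤x 0≤h) (^-nonNegative 0≤y (suc k)) x+h≤y (bernoulli 0≤x 0≤h x+h≤y k) ⟩
      y * (y * y ^ k) ∎
      where
      open ≤-Reasoning
      p = x ^ k
      s = fromℕ (suc k)
      +-nonNegative : ∀ {a b} → 0# ≤ a → 0# ≤ b → 0# ≤ a + b
      +-nonNegative 0≤a 0≤b = ≤-trans (≤-reflexive (sym (+-identityˡ 0#))) (+-mono-≤ 0≤a 0≤b)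
      0≤y : 0# ≤ y
      0≤y = ≤-trans (+-nonNegative 0≤x 0≤h) x+h≤y

    -- Bernoulli's inequality divided by the factorial of `suc k`.
    term-step : ∀ {x h y} → 0# ≤ x → 0# ≤ h → x + h ≤ y → ∀ k →
      term x (suc k) + h * term x k ≤ term y (suc k)
    term-step {x} {h} {y} 0≤x 0≤h x+h≤y k = begin
      x * p * u + h * (p * 1/ (k !) {{k !≢0}})  ≈⟨ +-congˡ (*-congˡ (*-congˡ (1/k!≈ k))) ⟨
      x * p * u + h * (p * (s * u))             ≈⟨ solve 5 (λ x p u h s → x :* p :* u :+ h :* (p :* (s :* u))
                                                    := (x :* p :+ s :* (p :* h)) :* u) refl x p u h s ⟩
      (x * p + s * (p * h)) * u                 ≤⟨ *-monoˡ-≤ (<⇒≤ (0<1/ (suc k !) {{suc k !≢0}}))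
                                                  (bernoulli 0≤x 0≤h x+h≤y k) ⟩
      y ^ suc k * u                             ∎
      where
      open ≤-Reasoning
      p = x ^ k
      s = fromℕ (suc k)
      u = 1/ (suc k !) {{suc k !≢0}}

  -- A truncated form of (1 + h) exp x ≤ exp (x + h). The term of index `k` multiplied by `h` is
  -- absorbed by the term of index `suc k`, so the right side has one more term.
  expSum-step : ∀ {x h y} → 0# ≤ x → 0# ≤ h → x + h ≤ y → ∀ n →
    (1# + h) * expSum x n ≤ expSum y (suc n)
  expSum-step {x} {h} {y} 0≤x 0≤h x+h≤y n = begin
    (1# + h) * expSum x n
      ≈⟨ solve 2 (λ h s → (con (+ 1) :+ h) :* s := s :+ h :* s) refl h (expSum x n) ⟩
    expSum x n + h * expSum x n
      ≤⟨ +-mono-≤ (partialSum-mono-≤ (term-nonNegative 0≤x) (ℕ.n≤1+n n)) (≤-reflexive (*-distribˡ-sum {n} h _)) ⟩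
    expSum x (suc n) + sum (λ (i : Fin n) → h * term x (toℕ i))
      ≈⟨ +-assoc _ _ _ ⟩
    term x 0 + (sum (λ (i : Fin n) → term x (suc (toℕ i))) + sum (λ (i : Fin n) → h * term x (toℕ i)))
      ≈⟨ +-congˡ (∑-distrib-+ (λ (i : Fin n) → term x (suc (toℕ i))) _) ⟨
    term x 0 + sum (λ (i : Fin n) → term x (suc (toℕ i)) + h * term x (toℕ i))
      ≤⟨ +-monoʳ-≤ _ (sum-mono-≤ (λ (i : Fin n) → term-step 0≤x 0≤h x+h≤y (toℕ i))) ⟩
    expSum y (suc n) ∎
    where
    open ≤-Reasoning

  -- Starting from exponent 0, each factor `1# + x` adds `x` to the exponent and one term to the
  -- sum. Staying with partial sums avoids constructing the exponential of `fromℕ m * x`.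
  [1+x]^m≤expSum : ∀ {x} → 0# ≤ x → ∀ m → (1# + x) ^ m ≤ expSum (fromℕ m * x) (suc m)
  [1+x]^m≤expSum {x} 0≤x zero = ≤-reflexive (begin
    1#                       ≈⟨ *-inverseʳ (fromℕ 1) (0<fromℕ 1) ⟨
    (1# + 0#) * 1/ 1         ≈⟨ *-congʳ (+-identityʳ 1#) ⟩
    1# * 1/ 1                ≈⟨ +-identityʳ _ ⟨
    expSum (0# * x) 1        ∎)
    where open SetoidReasoning setoid
  [1+x]^m≤expSum {x} 0≤x (suc m) = begin
    (1# + x) * (1# + x) ^ m
      ≤⟨ *-monoʳ-≤ (≤-trans (<⇒≤ 0<1) (0≤⇒1≤1+ 0≤x))
           ([1+x]^m≤expSum 0≤x m) ⟩
    (1# + x) * expSum (fromℕ m * x) (suc m)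
      ≤⟨ expSum-step (*-nonNegative (0≤fromℕ m) 0≤x) 0≤x
           (≤-reflexive (solve 2 (λ k x → k :* x :+ x := (con (+ 1) :+ k) :* x) refl (fromℕ m) x)) (suc m) ⟩
    expSum (fromℕ (suc m) * x) (suc (suc m)) ∎
    where open ≤-Reasoning

  -- Strictness comes from one further step by the gap `h` between `fromℕ m * x` and `y`, which
  -- gains a factor `1# + h` above 1.
  [1+x]^m<exp : ∀ {x y z} → 0# ≤ x → ∀ m → fromℕ m * x < y → IsExp y z → (1# + x) ^ m < z
  [1+x]^m<exp {x} {y} {z} 0≤x m mx<y y↦z = begin-strict
    (1# + x) ^ m
      ≈⟨ *-identityʳ _ ⟨
    (1# + x) ^ m * 1#
      <⟨ *-monoʳ-< (^-positive 0<1+x m) (0<⇒1<1+ 0<h) ⟩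
    (1# + x) ^ m * (1# + h)
      ≈⟨ *-comm _ _ ⟩
    (1# + h) * (1# + x) ^ m
      ≤⟨ *-monoʳ-≤ (<⇒≤ (<-trans 0<1 (0<⇒1<1+ 0<h))) ([1+x]^m≤expSum 0≤x m) ⟩
    (1# + h) * expSum (fromℕ m * x) (suc m)
      ≤⟨ expSum-step 0≤mx (<⇒≤ 0<h)
           (≤-reflexive (solve 2 (λ a y → a :+ (y :- a) := y) refl (fromℕ m * x) y)) (suc m) ⟩
    expSum y (suc (suc m))
      ≤⟨ partialSum-≤-limit (term-nonNegative (≤-trans 0≤mx (<⇒≤ mx<y))) y↦z (suc (suc m)) ⟩
    z ∎
    where
    open ≤-Reasoning
    h = y - fromℕ m * x
    0<h = 0<y-x mx<y
    0≤mx = *-nonNegative (0≤fromℕ m) 0≤x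
    0<1+x = <-≤-trans 0<1 (0≤⇒1≤1+ 0≤x)

  -- Approximate means of spikes

  axis : ∀ {d} → ℝ → Point (suc d)
  axis t zero    = t
  axis t (suc _) = 0#

  -- With the far point at position `zero`, a sample misses it exactly when no drawn position is
  -- `zero`.
  spike : ∀ {N d} → ℝ → Vector (Point (suc d)) (suc N)
  spike b zero    = axis b
  spike b (suc _) = axis 0#

  ‖axis-axis‖² : ∀ {d} s t → ‖ axis {d} s - axis t ‖² ≈ (s - t) ^ 2
  ‖axis-axis‖² {d} s t = begin
    (s - t) ^ 2 + sum {d} (λ _ → (0# - 0#) ^ 2)  ≈⟨ +-congˡ (sum-const d _) ⟩
    (s - t) ^ 2 + fromℕ d * (0# - 0#) ^ 2        ≈⟨ solve 2 (λ u k →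
                                                       u :+ k :* (con (+ 0) :- con (+ 0)) :^ 2 := u) refl _ (fromℕ d) ⟩
    (s - t) ^ 2                                  ∎
    where open SetoidReasoning setoid

  ‖axis-_‖²≥ : ∀ {d} s (x : Point (suc d)) → (s - x zero) ^ 2 ≤ ‖ axis s - x ‖²
  ‖axis- s ‖²≥ x = ≤-trans (≤-reflexive (sym (+-identityʳ _)))
    (+-monoʳ-≤ _ (sum-nonNegative (λ i → square-nonNegative (0# - x (suc i)))))

  module _ {N d : ℕ} where

    private
      k = fromℕ N
      n = fromℕ (suc N)

    cost-spike-axis : ∀ b t → cost (spike {N} {d} b) (axis t) ≈ (b - t) ^ 2 + k * (0# - t) ^ 2
    cost-spike-axis b t = begin
      cost (spike {N} {d} b) (axis t)
        ≈⟨ +-cong (‖axis-axis‖² {d} b t) (sum-const N _) ⟩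
      (b - t) ^ 2 + k * ‖ axis {d} 0# - axis t ‖²
        ≈⟨ +-congˡ (*-congˡ (‖axis-axis‖² {d} 0# t)) ⟩
      (b - t) ^ 2 + k * (0# - t) ^ 2 ∎
      where open SetoidReasoning setoid

    -- All input points lie on the axis, so the off-axis coordinates of `x` only add squares.
    cost-spike-≥ : ∀ b x → (b - x zero) ^ 2 + k * (0# - x zero) ^ 2 ≤ cost (spike {N} {d} b) x
    cost-spike-≥ b x = +-mono-≤ (‖axis- b ‖²≥ x) (const-≤-sum {N} (λ _ → ‖axis- 0# ‖²≥ x))

    -- The spike at height (N+1)β is scaled so that its mean is at height β.
    approxMean-spike : ∀ {ε β x} → 0# < ε → IsApproxMean ε (spike {N} {d} (n * β)) x →
      (x zero - β) ^ 2 ≤ k * ε * β ^ 2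
    approxMean-spike {ε} {β} {x} 0<ε (v , (_ , v≤) , cost≤) = *-cancelˡ-≤ (0<fromℕ (suc N))
      (+-cancelˡ-≤ (k * n * β ^ 2) (begin
        -- The cost of the axis point at height `y`, split into the cost `k * n * β ^ 2` at the mean
        -- and `n` times the squared distance to the mean.
        k * n * β ^ 2 + n * (y - β) ^ 2
          ≈⟨ solve 3 (λ k b y → let n = con (+ 1) :+ k in
                 k :* n :* b :^ 2 :+ n :* (y :- b) :^ 2
              := (n :* b :- y) :^ 2 :+ k :* (con (+ 0) :- y) :^ 2) refl k β y ⟩
        (n * β - y) ^ 2 + k * (0# - y) ^ 2
          ≤⟨ cost-spike-≥ (n * β) x ⟩
        cost (spike {N} {d} (n * β)) x
          ≤⟨ cost≤ ⟩
        (1# + ε) * v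
          ≤⟨ *-monoʳ-≤ (<⇒≤ (<-trans 0<1 (0<⇒1<1+ 0<ε))) (v≤ (axis {d} β)) ⟩
        (1# + ε) * cost (spike {N} {d} (n * β)) (axis {d} β)
          ≈⟨ *-congˡ (cost-spike-axis (n * β) β) ⟩
        (1# + ε) * ((n * β - β) ^ 2 + k * (0# - β) ^ 2)
          ≈⟨ solve 3 (λ k b e → let n = con (+ 1) :+ k in
                 (con (+ 1) :+ e) :* ((n :* b :- b) :^ 2 :+ k :* (con (+ 0) :- b) :^ 2)
              := k :* n :* b :^ 2 :+ n :* (k :* e :* b :^ 2)) refl k β ε ⟩
        k * n * β ^ 2 + n * (k * ε * β ^ 2) ∎))
      where
      open ≤-Reasoning
      y = x zero

  -- Closeness to `γ` gives `(1# - θ) * γ ≤ 2# * y`, and the size of `M` turns this into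
  -- `2# * β ≤ y`. Closeness to `β` bounds `y ^ 2 + (1# - θ) * β ^ 2` by `y * (2# * β)`, hence by
  -- `y ^ 2`, which is absurd.
  separated : ∀ {θ M β γ y} → θ < 1# → 2# * 2# ≤ (1# - θ) * M → 0# < β → M * β ≤ γ → 0# < γ →
    (y - β) ^ 2 ≤ θ * β ^ 2 → ¬ ((y - γ) ^ 2 ≤ θ * γ ^ 2)
  separated {θ} {M} {β} {γ} {y} θ<1 4≤[1-θ]M 0<β Mβ≤γ 0<γ nearβ nearγ = <-irrefl refl (begin-strict
    y ^ 2                                 ≈⟨ +-identityʳ _ ⟨
    y ^ 2 + 0#                            <⟨ +-monoʳ-< _ (*-positive 0<1-θ (^-positive 0<β 2)) ⟩
    y ^ 2 + (1# - θ) * β ^ 2              ≈⟨ +-identityʳ _ ⟨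
    y ^ 2 + (1# - θ) * β ^ 2 + 0#         ≤⟨ +-monoʳ-≤ _ (0≤y-x nearβ) ⟩
    y ^ 2 + (1# - θ) * β ^ 2 + (θ * β ^ 2 - (y - β) ^ 2)
                                          ≈⟨ solve 3 (λ y t b →
                                                 y :^ 2 :+ (con (+ 1) :- t) :* b :^ 2 :+ (t :* b :^ 2 :- (y :- b) :^ 2)
                                                 := y :* (con (+ 2) :* b)) refl y θ β ⟩
    y * (2# * β)                          ≤⟨ *-monoʳ-≤ 0≤y 2β≤y ⟩
    y * y                                 ≈⟨ *-congˡ (*-identityʳ y) ⟨
    y ^ 2                                 ∎)
    where
    open ≤-Reasoning

    0<1-θ : 0# < 1# - θ
    0<1-θ = 0<y-x θ<1

    [1-θ]γ≤2y : (1# - θ) * γ ≤ 2# * y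
    [1-θ]γ≤2y = *-cancelˡ-≤ 0<γ (x≤y⇐0≤y-x (begin
      0#                                    ≤⟨ square-nonNegative y ⟩
      y ^ 2                                 ≈⟨ +-identityʳ _ ⟨
      y ^ 2 + 0#                            ≤⟨ +-monoʳ-≤ _ (0≤y-x nearγ) ⟩
      y ^ 2 + (θ * γ ^ 2 - (y - γ) ^ 2)     ≈⟨ solve 3 (λ y t g → y :^ 2 :+ (t :* g :^ 2 :- (y :- g) :^ 2)
                                                 := g :* (con (+ 2) :* y) :- g :* ((con (+ 1) :- t) :* g)) refl y θ γ ⟩
      γ * (2# * y) - γ * ((1# - θ) * γ)     ∎))

    2β≤y : 2# * β ≤ y
    2β≤y = *-cancelˡ-≤ 0<2 (begin
      2# * (2# * β)       ≈⟨ *-assoc 2# 2# β ⟨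
      2# * 2# * β         ≤⟨ *-monoˡ-≤ (<⇒≤ 0<β) 4≤[1-θ]M ⟩
      (1# - θ) * M * β    ≈⟨ *-assoc (1# - θ) M β ⟩
      (1# - θ) * (M * β)  ≤⟨ *-monoʳ-≤ (<⇒≤ 0<1-θ) Mβ≤γ ⟩
      (1# - θ) * γ        ≤⟨ [1-θ]γ≤2y ⟩
      2# * y              ∎)

    0≤y : 0# ≤ y
    0≤y = ≤-trans (*-nonNegative (<⇒≤ 0<2) (<⇒≤ 0<β)) 2β≤y

  -- Consequences of the Archimedean property.

  archimedean-≤ : ∀ {x y} → (∀ n → fromℕ n * x ≤ y) → x ≤ 0#
  archimedean-≤ {x} {y} nx≤y 0<x with n , y/x<n ← archimedean (y * inverse x 0<x) = nx≤y n (begin-strict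
    y                          ≈⟨ *-identityʳ y ⟨
    y * 1#                     ≈⟨ *-congˡ (*-inverseʳ x 0<x) ⟨
    y * (x * inverse x 0<x)    ≈⟨ solve 3 (λ y x i → y :* (x :* i) := x :* (y :* i)) refl y x _ ⟩
    x * (y * inverse x 0<x)    <⟨ *-monoʳ-< 0<x y/x<n ⟩
    x * fromℕ n                ≈⟨ *-comm x (fromℕ n) ⟩
    fromℕ n * x                ∎)
    where open ≤-Reasoning

  -- The order is not decidable, so `N` exists only up to double negation, which suffices for
  -- proving a negation. Without such an `N`, induction from `ε < 1#` keeps every multiple of `ε`
  -- from reaching 1, against the Archimedean property.
  reciprocal-bracket : ∀ {ε} → 0# < ε → ε < 1# →
    ¬ ¬ (∃[ N ] fromℕ (suc N) * ε < 1# × 1# ≤ fromℕ (suc (suc N)) * ε)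
  reciprocal-bracket {ε} 0<ε ε<1 none =
    archimedean-≤ (λ n 1<nε → below n λ [1+n]ε<1 → <-asym 1<nε
      (≤-<-trans (*-monoˡ-≤ (<⇒≤ 0<ε) (n≤1+n n)) [1+n]ε<1)) 0<ε
    where
    n≤1+n : ∀ n → fromℕ n ≤ fromℕ (suc n)
    n≤1+n n = ≤-trans (≤-reflexive (sym (+-identityˡ _))) (+-monoˡ-≤ (fromℕ n) (<⇒≤ 0<1))

    below : ∀ n → ¬ (1# ≤ fromℕ (suc n) * ε)
    below zero    1≤ε = 1≤ε (<-respˡ-≈ (solve 1 (λ e → e := (con (+ 1) :+ con (+ 0)) :* e) refl ε) ε<1)
    below (suc n) 1≤[2+n]ε = below n λ [1+n]ε<1 → none (n , [1+n]ε<1 , 1≤[2+n]ε)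

  -- The probability that a sample misses the far point.

  module _ {o e i d m} (𝒜 : SublinearAlgorithm (suc d) m o e i) where

    open SublinearAlgorithm 𝒜
    open Probability randomness

    -- By `bound`, all multiples of the excess of the miss probability over `δ` stay below `δ`, so
    -- the excess cannot be positive.
    miss-probability-≤ : ∀ {N ε δ} → 0# < ε → fromℕ N * ε < 1# →
      (∀ (A : Vector (Point (suc d)) (suc N)) → ApproximatesMean 𝒜 ε (1# - δ) A) →
      (fromℕ N * 1/ (suc N)) ^ m ≤ δ
    miss-probability-≤ {N} {ε} {δ} 0<ε θ<1 approximates =
      λ δ<r → archimedean-≤ bound (0<y-x δ<r)
      where
      θ = fromℕ N * ε

      0<1-θ : 0# < 1# - θ
      0<1-θ = 0<y-x θ<1

      -- Chosen so that `(1# - θ) * M` is 4 plus the positive number `1# - θ`; the summand `1#`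
      -- makes the powers of `M` nondecreasing.
      M : ℝ
      M = 1# + 2# * 2# * inverse (1# - θ) 0<1-θ

      1≤M : 1# ≤ M
      1≤M = 0≤⇒1≤1+ (<⇒≤ (*-positive (*-positive 0<2 0<2) (inverse-positive (1# - θ) 0<1-θ)))

      4≤[1-θ]M : 2# * 2# ≤ (1# - θ) * M
      4≤[1-θ]M = begin
        2# * 2#                            ≈⟨ +-identityˡ _ ⟨
        0# + 2# * 2#                       ≤⟨ +-monoˡ-≤ _ (<⇒≤ 0<1-θ) ⟩
        (1# - θ) + 2# * 2#                 ≈⟨ +-congˡ (*-identityʳ _) ⟨
        (1# - θ) + 2# * 2# * 1#            ≈⟨ +-congˡ (*-congˡ (*-inverseʳ (1# - θ) 0<1-θ)) ⟨
        (1# - θ) + 2# * 2# * ((1# - θ) * inverse (1# - θ) 0<1-θ)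
          ≈⟨ solve 3 (λ u i f → u :+ f :* (u :* i) := u :* (con (+ 1) :+ f :* i)) refl (1# - θ) _ (2# * 2#) ⟩
        (1# - θ) * M                       ∎
        where open ≤-Reasoning

      0<M : 0# < M
      0<M = <-≤-trans 0<1 1≤M

      A : ℕ → Vector (Point (suc d)) (suc N)
      A k = spike (fromℕ (suc N) * M ^ k)

      E : ℕ → Vector (Fin (suc N)) m → Pred Ω e
      E k = proj₁ (approximates (A k))

      event : ∀ k s → IsEvent (E k s)
      event k = proj₁ (proj₂ (approximates (A k)))

      success : ∀ k s {ω} → E k s ω → IsApproxMean ε (A k) (output (A k ∘ s) ω)
      success k s = proj₁ (proj₂ (proj₂ (approximates (A k)))) s

      Avoids : Vector (Fin (suc N)) m → Set
      Avoids s = ∀ j → s j ≢ zero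

      spike-avoided : ∀ b {j : Fin (suc N)} → j ≢ zero → spike {N} {d} b j ≈ᵖ axis 0#
      spike-avoided b {zero}  0≢0 = ⊥-elim (0≢0 ≡.refl)
      spike-avoided b {suc j} _   = λ _ → refl

      -- The first coordinate of the answer to a sample consisting of origins only, which is the
      -- same for every input `A k`.
      guess : Ω → ℝ
      guess ω = output (λ _ → axis 0#) ω zero

      near : ∀ k {s ω} → Avoids s → E k s ω → (guess ω - M ^ k) ^ 2 ≤ θ * (M ^ k) ^ 2
      near k {s} {ω} s≢0 ω∈E = begin
        (guess ω - M ^ k) ^ 2
          -- The sample agrees with the constant origin sample only pointwise, so `output-cong`
          -- carries the answer over.
          ≈⟨ ^-congˡ 2 (+-congʳ (output-cong (λ j → spike-avoided _ (s≢0 j)) ω zero)) ⟨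
        (output (A k ∘ s) ω zero - M ^ k) ^ 2
          ≤⟨ approxMean-spike {N} {d} {x = output (A k ∘ s) ω} 0<ε (success k s ω∈E) ⟩
        θ * (M ^ k) ^ 2 ∎
        where open ≤-Reasoning

      disjoint-< : ∀ {j k s} → Avoids s → j ℕ.< k → E j s ⊥ E k s
      disjoint-< {j} {k} s≢0 j<k (ω∈Eⱼ , ω∈Eₖ) =
        separated θ<1 4≤[1-θ]M (^-positive 0<M j) (1≤⇒^-mono-≤ 1≤M j<k) (^-positive 0<M k)
          (near j s≢0 ω∈Eⱼ) (near k s≢0 ω∈Eₖ)

      disjoint : ∀ {j k s} → Avoids s → j ≢ k → E j s ⊥ E k s
      disjoint {j} {k} s≢0 j≢k (ω∈Eⱼ , ω∈Eₖ) with ℕ.<-cmp j k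
      ... | tri< j<k _ _ = disjoint-< s≢0 j<k (ω∈Eⱼ , ω∈Eₖ)
      ... | tri≈ _ j≡k _ = j≢k j≡k
      ... | tri> _ _ k<j = disjoint-< s≢0 k<j (ω∈Eₖ , ω∈Eⱼ)

      -- For `suc K` inputs the success probabilities sum to at most `1# + f` at each sample, and to
      -- at most `1#` at a sample missing the far point. Their average over samples is at least
      -- `(1# + f) * (1# - δ)`, and comparing the two bounds gives the claim.
      bound : ∀ K → fromℕ K * ((fromℕ N * 1/ (suc N)) ^ m - δ) ≤ δ
      bound K = begin
        f * (r - δ)
          ≈⟨ solve 3 (λ f r d → f :* (r :- d)
               := (con (+ 1) :+ f) :* (con (+ 1) :- d) :+ f :* r :- (con (+ 1) :+ f) :+ d) refl f r δ ⟩
        (1# + f) * (1# - δ) + f * r - (1# + f) + δ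
          ≤⟨ +-monoˡ-≤ δ (+-monoˡ-≤ _ (+-monoˡ-≤ _ (const-≤-sum {suc K}
               (λ k → proj₂ (proj₂ (proj₂ (approximates (A (toℕ k))))))))) ⟩
        sum {suc K} (λ k → average m (λ s → P (event (toℕ k) s))) + f * r - (1# + f) + δ
          ≈⟨ +-congʳ (+-congʳ (+-congʳ (average-sum {k = suc K} m (λ k s → P (event (toℕ k) s))))) ⟨
        average m (λ s → sum {suc K} (λ k → P (event (toℕ k) s))) + f * r - (1# + f) + δ
          ≤⟨ +-monoˡ-≤ δ (+-monoˡ-≤ _ (average-miss-≤ N m f
               (λ s → ≤-trans (sum-≤-const {suc K} (λ k → P≤1 (event (toℕ k) s))) (≤-reflexive (*-identityʳ _)))
               (λ s s≢0 → disjoint⇒sum≤1 {suc K} (λ k → event (toℕ k) s)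
                 (λ j≢k → disjoint s≢0 (j≢k ∘ toℕ-injective))))) ⟩
        1# + f - (1# + f) + δ
          ≈⟨ solve 2 (λ f d → f :- f :+ d := d) refl (1# + f) δ ⟩
        δ ∎
        where
        open ≤-Reasoning
        f = fromℕ K
        r = (fromℕ N * 1/ (suc N)) ^ m

  -- The bound on the sample size.

  1^n≈1 : ∀ n → 1# ^ n ≈ 1#
  1^n≈1 zero    = refl
  1^n≈1 (suc n) = trans (*-identityˡ _) (1^n≈1 n)

  -- One half is the loss in passing from `1# ≤ (1# + k) * ε` to `1# ≤ 2# * ε * k` for `k` at least
  -- 1.
  κ : ℝ
  κ = inverse 2# 0<2

  -- If `m` were too small, the exponential estimate would give (1 + 1/k)^m < 1/δ, where `k` counts
  -- the copies of the origin; the bound on the miss probability gives the opposite inequality.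
  sample-size-≥ : ∀ {o e i ε δ d m} (0<ε : 0# < ε) → ε < 1# → (0<δ : 0# < δ) →
    (𝒜 : SublinearAlgorithm (suc d) m o e i) →
    (∀ n .{{_ : NonZero n}} (A : Vector (Point (suc d)) n) → ApproximatesMean 𝒜 ε (1# - δ) A) →
    ∀ {ℓ} → IsLog (inverse δ 0<δ) ℓ → κ * inverse ε 0<ε * ℓ ≤ fromℕ m
  sample-size-≥ {ε = ε} {δ} {d} {m} 0<ε ε<1 0<δ 𝒜 approximates {ℓ} isLog m<κε⁻¹ℓ =
    reciprocal-bracket 0<ε ε<1 λ (N , Nε<1 , 1≤[1+N]ε) → contradict N Nε<1 1≤[1+N]ε
    where
    open ≤-Reasoning
    ε⁻¹ = inverse ε 0<ε
    δ⁻¹ = inverse δ 0<δ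

    -- The sign follows from the assumption being refuted: a negative `ℓ` would make `fromℕ m`
    -- negative.
    0≤ℓ : 0# ≤ ℓ
    0≤ℓ ℓ<0 = 0≤fromℕ m (begin-strict
      fromℕ m          <⟨ m<κε⁻¹ℓ ⟩
      κ * ε⁻¹ * ℓ      <⟨ *-monoʳ-< (*-positive (inverse-positive 2# 0<2) (inverse-positive ε 0<ε)) ℓ<0 ⟩
      κ * ε⁻¹ * 0#     ≈⟨ zeroʳ _ ⟩
      0#               ∎)

    contradict : ∀ N → fromℕ (suc N) * ε < 1# → ¬ (1# ≤ fromℕ (suc (suc N)) * ε)
    contradict N kε<1 1≤[1+k]ε = δ⁻¹≤[1+x]^m ([1+x]^m<exp (<⇒≤ (0<1/ (suc N))) m mx<ℓ isLog)
      where
      -- The number of copies of the origin, taken as a successor so that its reciprocal `x` exists;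
      -- the input then has `suc (suc N)` points.
      k = fromℕ (suc N)
      x = 1/ (suc N)
      w = 1/ (suc (suc N))

      kx≈1 : k * x ≈ 1#
      kx≈1 = *-inverseʳ k (0<fromℕ (suc N))

      κε⁻¹≤k : κ * ε⁻¹ ≤ k
      κε⁻¹≤k = *-cancelˡ-≤ (*-positive 0<2 0<ε) (begin
        2# * ε * (κ * ε⁻¹)    ≈⟨ solve 4 (λ a b c d → a :* b :* (c :* d) := a :* c :* (b :* d)) refl 2# ε κ ε⁻¹ ⟩
        2# * κ * (ε * ε⁻¹)    ≈⟨ *-cong (*-inverseʳ 2# 0<2) (*-inverseʳ ε 0<ε) ⟩
        1# * 1#               ≈⟨ *-identityˡ 1# ⟩
        1#                    ≤⟨ 1≤[1+k]ε ⟩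
        (1# + k) * ε          ≤⟨ *-monoˡ-≤ (<⇒≤ 0<ε) (+-monoˡ-≤ k (0≤⇒1≤1+ (0≤fromℕ N))) ⟩
        (k + k) * ε           ≈⟨ solve 2 (λ k e → (k :+ k) :* e := con (+ 2) :* e :* k) refl k ε ⟩
        2# * ε * k            ∎)

      mx<ℓ : fromℕ m * x < ℓ
      mx<ℓ = begin-strict
        fromℕ m * x           ≈⟨ *-comm _ x ⟩
        x * fromℕ m           <⟨ *-monoʳ-< (0<1/ (suc N)) m<κε⁻¹ℓ ⟩
        x * (κ * ε⁻¹ * ℓ)     ≤⟨ *-monoʳ-≤ (<⇒≤ (0<1/ (suc N))) (*-monoˡ-≤ 0≤ℓ κε⁻¹≤k) ⟩
        x * (k * ℓ)           ≈⟨ solve 3 (λ x k l → x :* (k :* l) := k :* x :* l) refl x k ℓ ⟩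
        k * x * ℓ             ≈⟨ *-congʳ kx≈1 ⟩
        1# * ℓ                ≈⟨ *-identityˡ ℓ ⟩
        ℓ                     ∎

      -- The chance `k * w` that one draw misses the far point is k/(k + 1), the reciprocal of 1 +
      -- 1/k.
      1≈kw[1+x] : 1# ≈ k * w * (1# + x)
      1≈kw[1+x] = begin-equality
        1#                    ≈⟨ *-inverseʳ _ (0<fromℕ (suc (suc N))) ⟨
        (1# + k) * w          ≈⟨ *-congʳ (+-congʳ kx≈1) ⟨
        (k * x + k) * w       ≈⟨ solve 3 (λ k x w → (k :* x :+ k) :* w := k :* w :* (con (+ 1) :+ x)) refl k x w ⟩
        k * w * (1# + x)      ∎

      δ⁻¹≤[1+x]^m : δ⁻¹ ≤ (1# + x) ^ m
      δ⁻¹≤[1+x]^m = *-cancelˡ-≤ 0<δ (begin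
        δ * δ⁻¹                       ≈⟨ *-inverseʳ δ 0<δ ⟩
        1#                            ≈⟨ 1^n≈1 m ⟨
        1# ^ m                        ≈⟨ ^-congˡ m 1≈kw[1+x] ⟩
        (k * w * (1# + x)) ^ m        ≈⟨ ^-distrib-* (k * w) (1# + x) m ⟩
        (k * w) ^ m * (1# + x) ^ m    ≤⟨ *-monoˡ-≤ (^-nonNegative (≤-trans (<⇒≤ 0<1) (0≤⇒1≤1+ (<⇒≤ (0<1/ (suc N))))) m)
                                           (miss-probability-≤ 𝒜 0<ε kε<1 (approximates (suc (suc N)))) ⟩
        δ * (1# + x) ^ m              ∎)

theorem5p1 : ∀ {c ℓ₁ ℓ₂ ℓ₃ o e i} (R : RealNumbers c ℓ₁ ℓ₂ ℓ₃) → let open Real R in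
    Σ[ κ ∈ ℝ ] 0# < κ ×
    (∀ (ε δ : ℝ) (0<ε : 0# < ε) → ε < 1# → (0<δ : 0# < δ) → δ < 1# →
    ∀ (d : ℕ) .{{_ : NonZero d}} (m : ℕ) (𝒜 : SublinearAlgorithm d m o e i) →
    (∀ (n : ℕ) .{{_ : NonZero n}} (A : Vector (Point d) n) →
    ApproximatesMean 𝒜 ε (1# - δ) A) →
    ∀ (logδ⁻¹ : ℝ) → IsLog (inverse δ 0<δ) logδ⁻¹ →
    κ * inverse ε 0<ε * logδ⁻¹ ≤ fromℕ m)
theorem5p1 R = κ , inverse-positive _ 0<2 , λ where
    -- Dimension zero contradicts the `NonZero` instance; a positive dimension provides the axis for
    -- the spikes.
    _ _ 0<ε ε<1 0<δ _ zero    m 𝒜 approximates _ isLog → ⊥-elim (ℕ.≢-nonZero⁻¹ 0 ≡.refl)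
    _ _ 0<ε ε<1 0<δ _ (suc d) m 𝒜 approximates _ isLog → sample-size-≥ 0<ε ε<1 0<δ 𝒜 approximates isLog
  where open LowerBound R
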